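{- For every integer $d\ge 3$, $$(d!)^{\frac{1}{2d}}>d^{\frac14}.$$ -}

module Defs where

open import Data.Nat.Base as ℕ using (ℕ; zero; suc)
import Data.Nat.Properties as ℕ
open import Data.Integer.Base using (+_)
open import Data.Rational.Base
open import Data.Rational.Properties
open import Data.Product.Base using (∃; _×_; _,_; proj₁; proj₂)
open import Data.Sum.Base using (_⊎_; inj₁; inj₂)
open import Relation.Nullary using (¬_; yes; no; contradiction)
open import Relation.Binary.PropositionalEquality
  using (_≡_; refl; sym; trans; cong; subst)
open import Algebra.Definitions.RawSemiring +-*-rawSemiring public
  using () renaming (_^_ to _^ℚ_)

-- Two-sided Dedekind cuts of ℚ.
record ℝ : Set₁ where
  field
    L U             : ℚ → Set
    lower-inhabited : ∃ L
    upper-inhabited : ∃ U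
    lower-closed    : ∀ {q r} → q < r → L r → L q
    lower-open      : ∀ {q} → L q → ∃ λ r → q < r × L r
    upper-closed    : ∀ {q r} → q < r → U q → U r
    upper-open      : ∀ {r} → U r → ∃ λ q → q < r × U q
    disjoint        : ∀ {q} → ¬ (L q × U q)
    located         : ∀ {q r} → q < r → L q ⊎ U r

open ℝ

infix 4 _<ℝ_ _>ℝ_

_<ℝ_ : ℝ → ℝ → Set
x <ℝ y = ∃ λ q → U x q × L y q

_>ℝ_ : ℝ → ℝ → Set
x >ℝ y = y <ℝ x

private
  p<p+1 : ∀ p → p < p + 1ℚ
  p<p+1 p = subst (_< p + 1ℚ) (+-identityʳ p) (+-monoʳ-< p (positive⁻¹ 1ℚ))

  p-q<p : ∀ p {q} → 0ℚ < q → p - q < p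
  p-q<p p 0<q = subst (p - _ <_) (+-identityʳ p) (+-monoʳ-< p (neg-antimono-< 0<q))

fromℚ : ℚ → ℝ
fromℚ a .L q = q < a
fromℚ a .U q = a < q
fromℚ a .lower-inhabited = a - 1ℚ , p-q<p a (positive⁻¹ 1ℚ)
fromℚ a .upper-inhabited = a + 1ℚ , p<p+1 a
fromℚ a .lower-closed = <-trans
fromℚ a .lower-open q<a = <-dense q<a
fromℚ a .upper-closed q<r a<q = <-trans a<q q<r
fromℚ a .upper-open a<r with <-dense a<r
... | m , a<m , m<r = m , m<r , a<m
fromℚ a .disjoint (q<a , a<q) = <-asym q<a a<q
fromℚ a .located {q} {r} q<r with q <? a
... | yes q<a = inj₁ q<a
... | no  q≮a = inj₂ (≤-<-trans (≮⇒≥ q≮a) q<r)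

fromℕ : ℕ → ℝ
fromℕ n = fromℚ (+ n / 1)

*-monoˡ-≤ : ∀ {r p q} → 0ℚ ≤ r → p ≤ q → r * p ≤ r * q
*-monoˡ-≤ {r} 0≤r = *-monoˡ-≤-nonNeg r {{nonNegative 0≤r}}

*-monoʳ-≤ : ∀ {r p q} → 0ℚ ≤ r → p ≤ q → p * r ≤ q * r
*-monoʳ-≤ {r} 0≤r = *-monoʳ-≤-nonNeg r {{nonNegative 0≤r}}

*-nonNeg : ∀ {p q} → 0ℚ ≤ p → 0ℚ ≤ q → 0ℚ ≤ p * q
*-nonNeg {p} 0≤p 0≤q = subst (_≤ p * _) (*-zeroʳ p) (*-monoˡ-≤ 0≤p 0≤q)

+-nonNeg : ∀ {p q} → 0ℚ ≤ p → 0ℚ ≤ q → 0ℚ ≤ p + q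
+-nonNeg {p} {q} 0≤p 0≤q = subst (_≤ p + q) (+-identityʳ 0ℚ) (+-mono-≤ 0≤p 0≤q)

^-nonNeg : ∀ {q} n → 0ℚ ≤ q → 0ℚ ≤ q ^ℚ n
^-nonNeg zero    0≤q = nonNegative⁻¹ 1ℚ
^-nonNeg (suc n) 0≤q = *-nonNeg 0≤q (^-nonNeg n 0≤q)

^-mono-≤ : ∀ {p q} n → 0ℚ ≤ p → p ≤ q → p ^ℚ n ≤ q ^ℚ n
^-mono-≤ zero    0≤p p≤q = ≤-refl
^-mono-≤ (suc n) 0≤p p≤q =
  ≤-trans (*-monoˡ-≤ 0≤p (^-mono-≤ n 0≤p p≤q))
          (*-monoʳ-≤ (^-nonNeg n (≤-trans 0≤p p≤q)) p≤q)

^-pos : ∀ {q} n → 0ℚ < q → 0ℚ < q ^ℚ n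
^-pos         zero    0<q = positive⁻¹ 1ℚ
^-pos {q} (suc n) 0<q =
  subst (_< q * q ^ℚ n) (*-zeroʳ q)
    (*-monoʳ-<-pos q {{positive 0<q}} (^-pos n 0<q))

^-mono-< : ∀ {p q} n .{{_ : ℕ.NonZero n}} → 0ℚ ≤ p → p < q → p ^ℚ n < q ^ℚ n
^-mono-< {p} {q} (suc n) 0≤p p<q =
  ≤-<-trans (*-monoˡ-≤ 0≤p (^-mono-≤ n 0≤p (<⇒≤ p<q)))
            (*-monoˡ-<-pos (q ^ℚ n) {{positive (^-pos n (≤-<-trans 0≤p p<q))}} p<q)

1≤^ : ∀ {q} n → 1ℚ ≤ q → 1ℚ ≤ q ^ℚ n
1≤^     zero    1≤q = ≤-refl
1≤^ {q} (suc n) 1≤q =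
  ≤-trans 1≤q (subst (_≤ q * q ^ℚ n) (*-identityʳ q)
    (*-monoˡ-≤ (≤-trans (nonNegative⁻¹ 1ℚ) 1≤q) (1≤^ n 1≤q)))

q≤q^n : ∀ {q} n .{{_ : ℕ.NonZero n}} → 1ℚ ≤ q → q ≤ q ^ℚ n
q≤q^n {q} (suc n) 1≤q =
  subst (_≤ q * q ^ℚ n) (*-identityʳ q)
    (*-monoˡ-≤ (≤-trans (nonNegative⁻¹ 1ℚ) 1≤q) (1≤^ n 1≤q))

^-lipschitz : ∀ n M → 0ℚ ≤ M →
  ∃ λ C → 0ℚ ≤ C ×
    (∀ p δ → 0ℚ ≤ p → 0ℚ ≤ δ → p + δ ≤ M → (p + δ) ^ℚ n ≤ p ^ℚ n + δ * C)
^-lipschitz zero M 0≤M = 0ℚ , ≤-refl , λ p δ _ _ _ →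
  ≤-reflexive (sym (trans (cong (λ z → 1ℚ + z) (*-zeroʳ δ)) (+-identityʳ 1ℚ)))
^-lipschitz (suc n) M 0≤M with ^-lipschitz n M 0≤M
... | C , 0≤C , bound = M ^ℚ n + M * C
                      , +-nonNeg (^-nonNeg n 0≤M) (*-nonNeg 0≤M 0≤C)
                      , step
  where
  expand : ∀ p δ a C → (p + δ) * (a + δ * C) ≡ p * a + δ * (a + (p + δ) * C)
  expand p δ a C =
    trans (*-distribˡ-+ (p + δ) a (δ * C))
    (trans (cong (λ z → z + (p + δ) * (δ * C)) (*-distribʳ-+ a p δ))
    (trans (+-assoc (p * a) (δ * a) ((p + δ) * (δ * C)))
    (cong (λ z → p * a + z)
    (trans (cong (λ z → δ * a + z) swap)
    (sym (*-distribˡ-+ δ a ((p + δ) * C)))))))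
    where
    swap : (p + δ) * (δ * C) ≡ δ * ((p + δ) * C)
    swap = trans (sym (*-assoc (p + δ) δ C))
          (trans (cong (λ z → z * C) (*-comm (p + δ) δ)) (*-assoc δ (p + δ) C))

  step : ∀ p δ → 0ℚ ≤ p → 0ℚ ≤ δ → p + δ ≤ M →
         (p + δ) ^ℚ suc n ≤ p ^ℚ suc n + δ * (M ^ℚ n + M * C)
  step p δ 0≤p 0≤δ p+δ≤M =
    ≤-trans (*-monoˡ-≤ (+-nonNeg 0≤p 0≤δ) (bound p δ 0≤p 0≤δ p+δ≤M))
    (≤-trans (≤-reflexive (expand p δ (p ^ℚ n) C))
    (+-monoʳ-≤ (p * p ^ℚ n) (*-monoˡ-≤ 0≤δ
      (+-mono-≤ (^-mono-≤ n 0≤p p≤M) (*-monoʳ-≤ 0≤C p+δ≤M)))))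
    where
    p≤M : p ≤ M
    p≤M = ≤-trans (subst (_≤ p + δ) (+-identityʳ p) (+-monoʳ-≤ p 0≤δ)) p+δ≤M

small : ∀ {b e C} → 0ℚ < b → 0ℚ < e → 0ℚ ≤ C →
        ∃ λ δ → 0ℚ < δ × δ < b × δ * C < e
small {b} {e} {C} 0<b 0<e 0≤C = go (<-dense 0<m)
  where
  D : ℚ
  D = C + 1ℚ

  C<D : C < D
  C<D = p<p+1 C

  instance
    D-pos : Positive D
    D-pos = positive (≤-<-trans 0≤C C<D)

    D≢0 : NonZero D
    D≢0 = pos⇒nonZero D

    1/D-pos : Positive (1/ D)
    1/D-pos = 1/pos⇒pos D

    e-pos : Positive e
    e-pos = positive 0<e

  s : ℚ
  s = e * 1/ D

  s*D≡e : s * D ≡ e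
  s*D≡e = trans (*-assoc e (1/ D) D)
         (trans (cong (λ z → e * z) (*-inverseˡ D)) (*-identityʳ e))

  0<s : 0ℚ < s
  0<s = positive⁻¹ s {{pos*pos⇒pos e (1/ D)}}

  0<m : 0ℚ < b ⊓ s
  0<m with ⊓-sel b s
  ... | inj₁ eq = subst (0ℚ <_) (sym eq) 0<b
  ... | inj₂ eq = subst (0ℚ <_) (sym eq) 0<s

  go : (∃ λ δ → 0ℚ < δ × δ < b ⊓ s) → ∃ λ δ → 0ℚ < δ × δ < b × δ * C < e
  go (δ , 0<δ , δ<m) =
    δ , 0<δ , <-≤-trans δ<m (p⊓q≤p b s) ,
    ≤-<-trans (*-monoˡ-≤ (<⇒≤ 0<δ) (<⇒≤ C<D))
      (subst (δ * D <_) s*D≡e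
        (*-monoˡ-<-pos D (<-≤-trans δ<m (p⊓q≤q b s))))

private
  0<q-p : ∀ {p q} → p < q → 0ℚ < q - p
  0<q-p {p} {q} p<q = subst (_< q - p) (+-inverseʳ p) (+-monoˡ-< (- p) p<q)

  [q-p]+p : ∀ p q → (q - p) + p ≡ q
  [q-p]+p p q = trans (+-assoc q (- p) p)
               (trans (cong (λ z → q + z) (+-inverseˡ p)) (+-identityʳ q))

  p+[q-p] : ∀ p q → p + (q - p) ≡ q
  p+[q-p] p q = trans (+-comm p (q - p)) ([q-p]+p p q)

^-continuous-above : ∀ {q t} n → 0ℚ ≤ q → q ^ℚ n < t →
                     ∃ λ r → q < r × r ^ℚ n < t
^-continuous-above {q} {t} n 0≤q q^n<t =
  go (^-lipschitz n (q + 1ℚ) (+-nonNeg 0≤q (nonNegative⁻¹ 1ℚ)))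
  where
  Goal : Set
  Goal = ∃ λ r → q < r × r ^ℚ n < t

  go : (∃ λ C → 0ℚ ≤ C × (∀ p δ → 0ℚ ≤ p → 0ℚ ≤ δ → p + δ ≤ q + 1ℚ →
          (p + δ) ^ℚ n ≤ p ^ℚ n + δ * C)) → Goal
  go (C , 0≤C , bound) = go′ (small (positive⁻¹ 1ℚ) (0<q-p q^n<t) 0≤C)
    where
    go′ : (∃ λ δ → 0ℚ < δ × δ < 1ℚ × δ * C < t - q ^ℚ n) → Goal
    go′ (δ , 0<δ , δ<1 , δC<e) = q + δ , q<q+δ , ≤-<-trans ≤₁ <₂
      where
      q<q+δ : q < q + δ
      q<q+δ = subst (_< q + δ) (+-identityʳ q) (+-monoʳ-< q 0<δ)

      ≤₁ : (q + δ) ^ℚ n ≤ q ^ℚ n + δ * C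
      ≤₁ = bound q δ 0≤q (<⇒≤ 0<δ) (+-monoʳ-≤ q (<⇒≤ δ<1))

      <₂ : q ^ℚ n + δ * C < t
      <₂ = subst (q ^ℚ n + δ * C <_) (p+[q-p] (q ^ℚ n) t)
             (+-monoʳ-< (q ^ℚ n) δC<e)

^-continuous-below : ∀ {q t} n → 0ℚ < q → t < q ^ℚ n →
                     ∃ λ r → 0ℚ < r × r < q × t < r ^ℚ n
^-continuous-below {q} {t} n 0<q t<q^n = go (^-lipschitz n q (<⇒≤ 0<q))
  where
  Goal : Set
  Goal = ∃ λ r → 0ℚ < r × r < q × t < r ^ℚ n

  go : (∃ λ C → 0ℚ ≤ C × (∀ p δ → 0ℚ ≤ p → 0ℚ ≤ δ → p + δ ≤ q →
          (p + δ) ^ℚ n ≤ p ^ℚ n + δ * C)) → Goal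
  go (C , 0≤C , bound) = go′ (small 0<q (0<q-p t<q^n) 0≤C)
    where
    go′ : (∃ λ δ → 0ℚ < δ × δ < q × δ * C < q ^ℚ n - t) → Goal
    go′ (δ , 0<δ , δ<q , δC<e) = r , 0<r , p-q<p q 0<δ , t<r^n
      where
      r : ℚ
      r = q - δ

      0<r : 0ℚ < r
      0<r = 0<q-p δ<q

      r+δ≡q : r + δ ≡ q
      r+δ≡q = [q-p]+p δ q

      q^n≤ : q ^ℚ n ≤ r ^ℚ n + δ * C
      q^n≤ = subst (λ z → z ^ℚ n ≤ r ^ℚ n + δ * C) r+δ≡q
        (bound r δ (<⇒≤ 0<r) (<⇒≤ 0<δ) (≤-reflexive r+δ≡q))

      q^n< : q ^ℚ n < r ^ℚ n + (q ^ℚ n - t)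
      q^n< = ≤-<-trans q^n≤ (+-monoʳ-< (r ^ℚ n) δC<e)

      t<r^n : t < r ^ℚ n
      t<r^n = ≰⇒> λ r^n≤t → <-irrefl (sym (p+[q-p] t (q ^ℚ n)))
        (<-≤-trans q^n< (+-monoˡ-≤ (q ^ℚ n - t) r^n≤t))

-- For x ≥ 0, the nonnegative n-th root of x: its lower cut is
-- { q | q < 0 or qⁿ < x } and its upper cut is { q | q > 0 and qⁿ > x }.
-- For x < 0, outside the intended domain, this gives 0.
infixr 8 _^1/_

_^1/_ : ℝ → (n : ℕ) → .{{ℕ.NonZero n}} → ℝ
(x ^1/ n) .L q = q < 0ℚ ⊎ L x (q ^ℚ n)
(x ^1/ n) .U q = 0ℚ < q × U x (q ^ℚ n)
(x ^1/ n) .lower-inhabited = - 1ℚ , inj₁ (negative⁻¹ (- 1ℚ))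
(x ^1/ n) .upper-inhabited with upper-inhabited x
... | u , Uu = v , <-≤-trans (positive⁻¹ 1ℚ) 1≤v , upper-closed x u<v^n Uu
  where
  v : ℚ
  v = (u + 1ℚ) ⊔ 1ℚ

  1≤v : 1ℚ ≤ v
  1≤v = p≤q⊔p (u + 1ℚ) 1ℚ

  u<v^n : u < v ^ℚ n
  u<v^n = <-≤-trans (<-≤-trans (p<p+1 u) (p≤p⊔q (u + 1ℚ) 1ℚ)) (q≤q^n n 1≤v)
(x ^1/ n) .lower-closed q<r (inj₁ r<0) = inj₁ (<-trans q<r r<0)
(x ^1/ n) .lower-closed {q} q<r (inj₂ Lr) with q <? 0ℚ
... | yes q<0 = inj₁ q<0
... | no  q≮0 = inj₂ (lower-closed x (^-mono-< n (≮⇒≥ q≮0) q<r) Lr)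
(x ^1/ n) .lower-open {q} Lq with q <? 0ℚ | Lq
... | yes q<0 | _        = let m , q<m , m<0 = <-dense q<0 in m , q<m , inj₁ m<0
... | no  q≮0 | inj₁ q<0 = contradiction q<0 q≮0
... | no  q≮0 | inj₂ Lqⁿ =
  let t , qⁿ<t , Lt = lower-open x Lqⁿ
      r , q<r , rⁿ<t = ^-continuous-above n (≮⇒≥ q≮0) qⁿ<t
  in r , q<r , inj₂ (lower-closed x rⁿ<t Lt)
(x ^1/ n) .upper-closed q<r (0<q , Uq) =
  <-trans 0<q q<r , upper-closed x (^-mono-< n (<⇒≤ 0<q) q<r) Uq
(x ^1/ n) .upper-open (0<r , Ur) =
  let t , t<rⁿ , Ut = upper-open x Ur
      q , 0<q , q<r , t<qⁿ = ^-continuous-below n 0<r t<rⁿ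
  in q , q<r , 0<q , upper-closed x t<qⁿ Ut
(x ^1/ n) .disjoint (inj₁ q<0 , 0<q , _)  = <-asym q<0 0<q
(x ^1/ n) .disjoint (inj₂ Lq  , _   , Uq) = disjoint x (Lq , Uq)
(x ^1/ n) .located {q} q<r with q <? 0ℚ
... | yes q<0 = inj₁ (inj₁ q<0)
... | no  q≮0 with located x (^-mono-< n (≮⇒≥ q≮0) q<r)
...   | inj₁ Lq = inj₁ (inj₂ Lq)
...   | inj₂ Ur = inj₂ (≤-<-trans (≮⇒≥ q≮0) q<r , Ur)

2*d≢0 : ∀ {d} → d ℕ.≥ 3 → ℕ.NonZero (2 ℕ.* d)
2*d≢0 {suc d} _ = _

{-# OPTIONS --safe #-}
-- It suffices to find a rational r > 0 with d < r⁴ and r²ᵈ < d!. Since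
-- dᵈ < (d!)², continuity gives a rational e > d with eᵈ < (d!)², and the
-- fourth powers of rationals are dense in [1, ∞), so d < r⁴ < e for some r;
-- then (r²ᵈ)² = (r⁴)ᵈ < (d!)². The bound dᵈ < (d!)² follows by induction on d
-- from 27 < 36 and (d + 1)ᵈ ≤ (d + 1) dᵈ.
module Submission where

open import Defs
open import Data.Nat.Base using (ℕ; _≥_; _*_; _!)

import Algebra.Properties.Group as GroupProperties
import Algebra.Properties.Semiring.Exp as Exp
open import Algebra.Bundles using (module CommutativeRing)
open import Data.Integer.Base as ℤ using (+_)
import Data.Integer.Properties as ℤ
open import Data.Nat.Base as ℕ using (zero; suc)
open import Data.Nat.Coprimality using (1-coprimeTo) renaming (sym to coprime-sym)
import Data.Nat.Properties as ℕ
open import Data.Nat.Tactic.RingSolver using (solve-∀)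
open import Data.Product.Base using (∃; _×_; _,_)
open import Data.Rational.Base as ℚ using (ℚ; mkℚ; 0ℚ; 1ℚ; 1/_; *<*; _/_)
open import Data.Rational.Literals using (fromℤ)
import Data.Rational.Properties as ℚ
open import Data.Sum.Base using (inj₂)
open import Relation.Binary.PropositionalEquality
  using (_≡_; refl; sym; trans; cong; cong₂; subst; subst₂)
open import Relation.Nullary using (¬_; yes; no; contradiction)
open import Relation.Unary using (Decidable)

open Exp (CommutativeRing.semiring ℚ.+-*-commutativeRing) using (^-assocʳ)
open GroupProperties ℚ.+-0-group using (//-rightDividesˡ)

-- Only `k = n` is used later; separating exponent from base allows induction on `k`. One more
-- factor `suc n` costs an extra `suc k * n ^ k`, which is at most `n * n ^ k` because `suc k ≤ n`.
[1+n]^k≤[1+k]*n^k : ∀ n k → k ℕ.≤ n → suc n ℕ.^ k ℕ.≤ suc k * n ℕ.^ k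
[1+n]^k≤[1+k]*n^k n zero    _   = ℕ.≤-refl
[1+n]^k≤[1+k]*n^k n (suc k) k<n = begin
  suc n * suc n ℕ.^ k              ≤⟨ ℕ.*-monoʳ-≤ (suc n) ([1+n]^k≤[1+k]*n^k n k (ℕ.<⇒≤ k<n)) ⟩
  suc n * (suc k * n ℕ.^ k)        ≡⟨ expand n k (n ℕ.^ k) ⟩
  suc k * (n * n ℕ.^ k) ℕ.+ suc k * n ℕ.^ k
    ≤⟨ ℕ.+-monoʳ-≤ (suc k * (n * n ℕ.^ k)) (ℕ.*-monoˡ-≤ (n ℕ.^ k) k<n) ⟩
  suc k * (n * n ℕ.^ k) ℕ.+ n * n ℕ.^ k
    ≡⟨ ℕ.+-comm (suc k * (n * n ℕ.^ k)) (n * n ℕ.^ k) ⟩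
  suc (suc k) * (n * n ℕ.^ k)      ∎
  where
  open ℕ.≤-Reasoning
  expand : ∀ n k x → suc n * (suc k * x) ≡ suc k * (n * x) ℕ.+ suc k * x
  expand = solve-∀

n^n<[n!]^2 : ∀ {n} → n ≥ 3 → n ℕ.^ n ℕ.< (n !) ℕ.^ 2
n^n<[n!]^2 n≥3 with ℕ.≤⇒≤′ n≥3
-- At `n = 3` the claim `27 < 36` unfolds to `28 ≤ 28 + 8`.
... | ℕ.≤′-reflexive refl   = ℕ.m≤m+n 28 8
... | ℕ.≤′-step {n} 3≤′n = begin-strict
  suc n * suc n ℕ.^ n              ≤⟨ ℕ.*-monoʳ-≤ (suc n) ([1+n]^k≤[1+k]*n^k n n ℕ.≤-refl) ⟩
  suc n * (suc n * n ℕ.^ n)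
    <⟨ ℕ.*-monoʳ-< (suc n) (ℕ.*-monoʳ-< (suc n) (n^n<[n!]^2 (ℕ.≤′⇒≤ 3≤′n))) ⟩
  suc n * (suc n * (n !) ℕ.^ 2)    ≡⟨ regroup (suc n) (n !) ⟩
  (suc n * n !) ℕ.^ 2              ∎
  where
  open ℕ.≤-Reasoning
  regroup : ∀ m x → m * (m * (x * (x * 1))) ≡ m * x * (m * x * 1)
  regroup = solve-∀

-- `_/_` divides by a gcd that is stuck on a variable `n`, whereas `fromℤ` is in constructor form,
-- so arithmetic and order on it compute.
n/1≡fromℤ : ∀ n → + n / 1 ≡ fromℤ (+ n)
n/1≡fromℤ n = ℚ.normalize-coprime (coprime-sym (1-coprimeTo n))

/1-homo-* : ∀ m n → + (m * n) / 1 ≡ (+ m / 1) ℚ.* (+ n / 1)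
/1-homo-* m n = trans (cong (_/ 1) (ℤ.pos-* m n))
  (sym (cong₂ ℚ._*_ (n/1≡fromℤ m) (n/1≡fromℤ n)))

/1-homo-^ : ∀ m k → + (m ℕ.^ k) / 1 ≡ (+ m / 1) ^ℚ k
/1-homo-^ m zero    = refl
/1-homo-^ m (suc k) =
  trans (/1-homo-* m (m ℕ.^ k)) (cong ((+ m / 1) ℚ.*_) (/1-homo-^ m k))

/1-suc : ∀ n → + suc n / 1 ≡ 1ℚ ℚ.+ (+ n / 1)
-- Adding fractions over denominator 1 leaves the numerator `+ 1 ℤ.+ + n ℤ.* + 1`, hence the factor
-- inserted here.
/1-suc n = trans (cong (λ i → (+ 1 ℤ.+ i) / 1) (sym (ℤ.*-identityʳ (+ n))))
  (sym (cong (1ℚ ℚ.+_) (n/1≡fromℤ n)))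

/1-mono-< : ∀ {m n} → m ℕ.< n → (+ m / 1) ℚ.< (+ n / 1)
/1-mono-< {m} {n} m<n = subst₂ ℚ._<_ (sym (n/1≡fromℤ m)) (sym (n/1≡fromℤ n))
  (*<* (ℤ.*-monoʳ-<-pos (+ 1) (ℤ.+<+ m<n)))

0≤n/1 : ∀ n → 0ℚ ℚ.≤ (+ n / 1)
0≤n/1 zero    = ℚ.≤-refl
0≤n/1 (suc n) = ℚ.<⇒≤ (/1-mono-< {0} {suc n} ℕ.z<s)

unbounded : ∀ p → ∃ λ n → p ℚ.< (+ n / 1)
-- A nonnegative fraction is at most its numerator `m`, since its denominator is at least 1.
unbounded p@(mkℚ (+ m) _ _) = suc m , subst (p ℚ.<_) (sym (n/1≡fromℤ (suc m)))
  (*<* (ℤ.<-≤-trans (ℤ.*-monoʳ-<-pos (+ 1) (ℤ.+<+ (ℕ.n<1+n m)))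
                    (ℤ.*-monoˡ-≤-nonNeg (+ suc m) (ℤ.+≤+ (ℕ.s≤s ℕ.z≤n)))))
unbounded p@(mkℚ ℤ.-[1+ _ ] _ _) = 0 , ℚ.negative⁻¹ p

archimedean : ∀ p {δ} → 0ℚ ℚ.< δ → ∃ λ n → p ℚ.< (+ n / 1) ℚ.* δ
archimedean p {δ} 0<δ =
  let n , p/δ<n = unbounded (p ℚ.* 1/ δ)
  in n , subst (ℚ._< (+ n / 1) ℚ.* δ) p/δ*δ≡p (ℚ.*-monoˡ-<-pos δ p/δ<n)
  where
  instance
    δ-pos = ℚ.positive 0<δ
    δ≢0   = ℚ.pos⇒nonZero δ

  p/δ*δ≡p : p ℚ.* 1/ δ ℚ.* δ ≡ p
  p/δ*δ≡p = trans (ℚ.*-assoc p (1/ δ) δ)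
    (trans (cong (p ℚ.*_) (ℚ.*-inverseˡ δ)) (ℚ.*-identityʳ p))

-- Searches downwards from `n` for the first failure of `P`, which `¬ P 0` guarantees.
first-step : ∀ {P : ℕ → Set} → Decidable P → ¬ P 0 → ∀ n → P n →
             ∃ λ k → ¬ P k × P (suc k)
first-step P? ¬P0 zero    P0 = contradiction P0 ¬P0
first-step P? ¬P0 (suc n) Pn with P? n
... | no ¬Pn  = n , ¬Pn , Pn
... | yes Pn′ = first-step P? ¬P0 n Pn′

p<q⇒0<q-p : ∀ {p q} → p ℚ.< q → 0ℚ ℚ.< q ℚ.- p
p<q⇒0<q-p {p} {q} p<q =
  subst (ℚ._< q ℚ.- p) (ℚ.+-inverseʳ p) (ℚ.+-monoˡ-< (ℚ.- p) p<q)

p+[q-p]≡q : ∀ p q → p ℚ.+ (q ℚ.- p) ≡ q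
p+[q-p]≡q p q = trans (ℚ.+-comm p (q ℚ.- p)) (//-rightDividesˡ p q)

-- Walking in steps of δ, the first n-th power beyond a is below b, because on
-- [0, a + 1] the n-th power is Lipschitz.
^-dense : ∀ {a b} n .{{_ : ℕ.NonZero n}} → 1ℚ ℚ.≤ a → a ℚ.< b →
          ∃ λ r → 0ℚ ℚ.< r × a ℚ.< r ^ℚ n × r ^ℚ n ℚ.< b
^-dense {a} {b} n@(suc n-1) 1≤a a<b =
  let C , 0≤C , lipschitz      = ^-lipschitz n (a ℚ.+ 1ℚ) 0≤a+1
      -- `δ < 1` keeps `p + δ` inside the Lipschitz interval when `p ≤ a`; `δ * C < b - a` keeps one
      -- step from jumping over the gap.
      δ , 0<δ , δ<1 , δ*C<b-a  = small (ℚ.positive⁻¹ 1ℚ) (p<q⇒0<q-p a<b) 0≤C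
      N , a<N*δ                = archimedean a 0<δ
      k , below , above        =
        first-step (λ k → a ℚ.<? ((+ k / 1) ℚ.* δ) ^ℚ n) (≯0 δ)
          N (a<p⇒a<p^n ((+ N / 1) ℚ.* δ) a<N*δ)
      p     = (+ k / 1) ℚ.* δ
      0≤p   = *-nonNeg (0≤n/1 k) (ℚ.<⇒≤ 0<δ)
      p≤a   = ℚ.≮⇒≥ {a} {p} (λ a<p → below (a<p⇒a<p^n p a<p))
  in p ℚ.+ δ
   , ℚ.<-≤-trans 0<δ
       (subst (ℚ._≤ p ℚ.+ δ) (ℚ.+-identityˡ δ) (ℚ.+-monoˡ-≤ δ 0≤p))
   , subst (λ x → a ℚ.< x ^ℚ n) (next k δ) above
   , (begin-strict
       (p ℚ.+ δ) ^ℚ n        ≤⟨ lipschitz p δ 0≤p (ℚ.<⇒≤ 0<δ) (ℚ.+-mono-≤ p≤a (ℚ.<⇒≤ δ<1)) ⟩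
       p ^ℚ n ℚ.+ δ ℚ.* C    ≤⟨ ℚ.+-monoˡ-≤ (δ ℚ.* C) (ℚ.≮⇒≥ below) ⟩
       a ℚ.+ δ ℚ.* C         <⟨ ℚ.+-monoʳ-< a δ*C<b-a ⟩
       a ℚ.+ (b ℚ.- a)       ≡⟨ p+[q-p]≡q a b ⟩
       b                     ∎)
  where
  open ℚ.≤-Reasoning

  0≤a : 0ℚ ℚ.≤ a
  0≤a = ℚ.≤-trans (ℚ.nonNegative⁻¹ 1ℚ) 1≤a

  0≤a+1 : 0ℚ ℚ.≤ a ℚ.+ 1ℚ
  0≤a+1 = +-nonNeg 0≤a (ℚ.nonNegative⁻¹ 1ℚ)

  -- Beyond 1 a power dominates its base. This lets the walk end at `N` and forces `p ≤ a` for every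
  -- point whose power has not passed `a`.
  a<p⇒a<p^n : ∀ p → a ℚ.< p → a ℚ.< p ^ℚ n
  a<p⇒a<p^n p a<p = ℚ.<-≤-trans a<p (q≤q^n n (ℚ.≤-trans 1≤a (ℚ.<⇒≤ a<p)))

  ≯0 : ∀ δ → ¬ a ℚ.< (0ℚ ℚ.* δ) ^ℚ n
  ≯0 δ a<0 = ℚ.<-irrefl refl (ℚ.≤-<-trans 0≤a (subst (a ℚ.<_) 0^n≡0 a<0))
    where
    0^n≡0 : (0ℚ ℚ.* δ) ^ℚ n ≡ 0ℚ
    0^n≡0 = trans (cong (ℚ._* (0ℚ ℚ.* δ) ^ℚ n-1) (ℚ.*-zeroˡ δ))
                  (ℚ.*-zeroˡ ((0ℚ ℚ.* δ) ^ℚ n-1))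

  next : ∀ k δ → (+ suc k / 1) ℚ.* δ ≡ (+ k / 1) ℚ.* δ ℚ.+ δ
  next k δ = trans (cong (ℚ._* δ) (trans (/1-suc k) (ℚ.+-comm 1ℚ (+ k / 1))))
    (trans (ℚ.*-distribʳ-+ δ (+ k / 1) 1ℚ)
           (cong ((+ k / 1) ℚ.* δ ℚ.+_) (ℚ.*-identityˡ δ)))

^-cancel-< : ∀ {p q} n → 0ℚ ℚ.≤ q → p ^ℚ n ℚ.< q ^ℚ n → p ℚ.< q
^-cancel-< n 0≤q p^n<q^n =
  ℚ.≰⇒> λ q≤p → ℚ.<-irrefl refl (ℚ.<-≤-trans p^n<q^n (^-mono-≤ n 0≤q q≤p))

lemma3p2 : ∀ (d : ℕ) (d≥3 : d ≥ 3) →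
    (fromℕ (d !) ^1/ (2 * d)) {{2*d≢0 d≥3}} >ℝ fromℕ d ^1/ 4
lemma3p2 d d≥3 =
  let e , d<e , e^d<d!² = ^-continuous-above d (0≤n/1 d) d^d<d!²
      r , 0<r , d<r⁴ , r⁴<e = ^-dense 4 1≤d d<e
      r^2d²<d!² = subst (ℚ._< (+ (d !) / 1) ^ℚ 2) (r⁴^d≡r^2d^2 r)
        (ℚ.≤-<-trans (^-mono-≤ d (^-nonNeg 4 (ℚ.<⇒≤ 0<r)) (ℚ.<⇒≤ r⁴<e)) e^d<d!²)
  -- `r` separates the two roots: it lies in the upper cut of the fourth root of `d`, and cancelling
  -- a square gives `r ^ℚ (2 * d) < d !`, which puts it in the lower cut of the other root.
  in r , (0<r , d<r⁴) , inj₂ (^-cancel-< 2 (0≤n/1 (d !)) r^2d²<d!²)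
  where
  d^d<d!² : (+ d / 1) ^ℚ d ℚ.< (+ (d !) / 1) ^ℚ 2
  d^d<d!² = subst₂ ℚ._<_ (/1-homo-^ d d) (/1-homo-^ (d !) 2)
    (/1-mono-< (n^n<[n!]^2 d≥3))

  1≤d : 1ℚ ℚ.≤ (+ d / 1)
  1≤d = ℚ.<⇒≤ (/1-mono-< {1} (ℕ.<-≤-trans (ℕ.s≤s (ℕ.s≤s ℕ.z≤n)) d≥3))

  r⁴^d≡r^2d^2 : ∀ r → (r ^ℚ 4) ^ℚ d ≡ (r ^ℚ (2 * d)) ^ℚ 2
  r⁴^d≡r^2d^2 r = trans (^-assocʳ r 4 d)
    (trans (cong (r ^ℚ_) (4*d≡2*d*2 d)) (sym (^-assocʳ r (2 * d) 2)))
    where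
    4*d≡2*d*2 : ∀ d → 4 * d ≡ 2 * d * 2
    4*d≡2*d*2 = solve-∀
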